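{- Let $n\in\mathbb{N}$ and, for each $i=1,\ldots,n$, let $\lambda_i^-,\lambda_i^+:\mathbb{N}\to\mathbb{R}$ be sequences such that for each $m\in\mathbb{N}$ and $1\le i\le n$, $$(1*\lambda_i^-)(m)\le(1*\mu)(m)\le(1*\lambda_i^+)(m).$$ Then for each $\mathbf m=(m_1,\ldots,m_n)\in\mathbb{N}^n$, $$\prod_{i=1}^n(1*\mu)(m_i)\ \ge\ \sum_{i=1}^n(1*\lambda_i^-)(m_i)\prod_{\substack{1\le j\le n \\ j\ne i}}(1*\lambda_j^+)(m_j)-(n-1)\prod_{i=1}^n(1*\lambda_i^+)(m_i).$$
   Context: $\mu$ is the Möbius function and $*$ denotes Dirichlet convolution: $(1*\lambda)(m)=\sum_{k\mid m}\lambda(k)$. -}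

module Defs where

open import Data.Bool.Base using (if_then_else_)
open import Data.Fin.Base using (Fin)
import Data.Fin.Properties as Fin
open import Data.Integer.Base as ℤ using (ℤ; 0ℤ; -1ℤ)
open import Data.List.Base using (List; filter; foldr; map; applyUpTo; allFin; length)
open import Data.List.Relation.Unary.Unique.DecPropositional using (unique?)
open import Data.Nat.Base as ℕ using (ℕ; zero; suc; _⊔_)
import Data.Nat.Properties as ℕ
open import Data.Nat.Divisibility using (_∣?_)
open import Data.Nat.Primality.Factorisation using (factorise; factors)
open import Data.Product.Base using (∃-syntax; _×_; _,_)
open import Data.Rational.Base as ℚ using (ℚ; 0ℚ; 1ℚ; ½; ∣_∣; 1/_; _/_; Positive; positive)
import Data.Rational.Properties as ℚ
open import Data.Rational.Solver using (module +-*-Solver)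
open import Relation.Binary.PropositionalEquality using (_≡_; refl; sym; trans; cong; subst)
open import Relation.Nullary.Decidable using (does; ¬?)

IsCauchy : (ℕ → ℚ) → Set
IsCauchy x = ∀ ε → 0ℚ ℚ.< ε → ∃[ N ] (∀ m n → N ℕ.≤ m → N ℕ.≤ n → ∣ x m ℚ.- x n ∣ ℚ.< ε)

-- Reals are Cauchy sequences of rationals, and _≤_ below compares their limits.
-- No quotient is taken: two sequences stand for the same real number
-- exactly when each is _≤_ the other.
record ℝ : Set where
  constructor mkℝ
  field
    seq    : ℕ → ℚ
    cauchy : IsCauchy seq

open ℝ public

infix 4 _≤_ _≥_

_≤_ : ℝ → ℝ → Set
x ≤ y = ∀ ε → 0ℚ ℚ.< ε → ∃[ N ] (∀ n → N ℕ.≤ n → seq x n ℚ.≤ seq y n ℚ.+ ε)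

_≥_ : ℝ → ℝ → Set
x ≥ y = y ≤ x

half-pos : ∀ {ε} → 0ℚ ℚ.< ε → 0ℚ ℚ.< ½ ℚ.* ε
half-pos {ε} 0<ε = ℚ.positive⁻¹ (½ ℚ.* ε) {{ℚ.pos*pos⇒pos ½ ε {{positive 0<ε}}}}

halves : ∀ ε → ½ ℚ.* ε ℚ.+ ½ ℚ.* ε ≡ ε
halves ε = trans (sym (ℚ.*-distribʳ-+ ε ½ ½)) (ℚ.*-identityˡ ε)

const-cauchy : ∀ q → IsCauchy (λ _ → q)
const-cauchy q ε 0<ε = 0 , λ _ _ _ _ →
  subst (λ z → ∣ z ∣ ℚ.< ε) (sym (ℚ.+-inverseʳ q)) 0<ε

neg-cauchy : ∀ {x} → IsCauchy x → IsCauchy (λ n → ℚ.- x n)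
neg-cauchy {x} cx ε 0<ε with cx ε 0<ε
... | N , p = N , λ m n N≤m N≤n →
  subst (ℚ._< ε)
    (trans (sym (ℚ.∣-p∣≡∣p∣ (x m ℚ.- x n))) (cong ∣_∣ (ℚ.neg-distrib-+ (x m) (ℚ.- x n))))
    (p m n N≤m N≤n)

+-cauchy : ∀ {x y} → IsCauchy x → IsCauchy y → IsCauchy (λ n → x n ℚ.+ y n)
+-cauchy {x} {y} cx cy ε 0<ε with cx (½ ℚ.* ε) (half-pos 0<ε) | cy (½ ℚ.* ε) (half-pos 0<ε)
... | M , p | N , q = M ⊔ N , λ m n ≤m ≤n → begin-strict
  ∣ (x m ℚ.+ y m) ℚ.- (x n ℚ.+ y n) ∣
    ≡⟨ cong ∣_∣ (regroup (x m) (y m) (x n) (y n)) ⟩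
  ∣ (x m ℚ.- x n) ℚ.+ (y m ℚ.- y n) ∣
    ≤⟨ ℚ.∣p+q∣≤∣p∣+∣q∣ (x m ℚ.- x n) (y m ℚ.- y n) ⟩
  ∣ x m ℚ.- x n ∣ ℚ.+ ∣ y m ℚ.- y n ∣
    <⟨ ℚ.+-mono-< (p m n (ℕ.m⊔n≤o⇒m≤o M N ≤m) (ℕ.m⊔n≤o⇒m≤o M N ≤n))
                  (q m n (ℕ.m⊔n≤o⇒n≤o M N ≤m) (ℕ.m⊔n≤o⇒n≤o M N ≤n)) ⟩
  ½ ℚ.* ε ℚ.+ ½ ℚ.* ε
    ≡⟨ halves ε ⟩
  ε ∎
  where
  open ℚ.≤-Reasoning
  regroup : ∀ a b c d → (a ℚ.+ b) ℚ.- (c ℚ.+ d) ≡ (a ℚ.- c) ℚ.+ (b ℚ.- d)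
  regroup = solve 4 (λ a b c d → (a :+ b) :- (c :+ d) := (a :- c) :+ (b :- d)) refl
    where open +-*-Solver

cauchy-bounded : ∀ {x} → IsCauchy x →
  ∃[ B ] Positive B × ∃[ N ] (∀ n → N ℕ.≤ n → ∣ x n ∣ ℚ.≤ B)
cauchy-bounded {x} cx with cx 1ℚ (ℚ.positive⁻¹ 1ℚ)
... | N , p = 1ℚ ℚ.+ ∣ x N ∣ , ℚ.pos+nonNeg⇒pos 1ℚ ∣ x N ∣ {{ℚ.∣-∣-nonNeg (x N)}} , N ,
  λ n N≤n → begin
    ∣ x n ∣                       ≡⟨ cong ∣_∣ (regroup (x n) (x N)) ⟩
    ∣ (x n ℚ.- x N) ℚ.+ x N ∣     ≤⟨ ℚ.∣p+q∣≤∣p∣+∣q∣ (x n ℚ.- x N) (x N) ⟩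
    ∣ x n ℚ.- x N ∣ ℚ.+ ∣ x N ∣   ≤⟨ ℚ.+-monoˡ-≤ ∣ x N ∣ (ℚ.<⇒≤ (p n N N≤n ℕ.≤-refl)) ⟩
    1ℚ ℚ.+ ∣ x N ∣                ∎
  where
  open ℚ.≤-Reasoning
  regroup : ∀ a b → a ≡ (a ℚ.- b) ℚ.+ b
  regroup = solve 2 (λ a b → a := (a :- b) :+ b) refl
    where open +-*-Solver

small-factor : ∀ B → Positive B → ∀ ε → 0ℚ ℚ.< ε →
  ∃[ δ ] 0ℚ ℚ.< δ × (∀ a b → ∣ a ∣ ℚ.≤ B → ∣ b ∣ ℚ.< δ → ∣ a ℚ.* b ∣ ℚ.< ε)
small-factor B B-pos ε 0<ε = 1/B ℚ.* ε , ℚ.positive⁻¹ (1/B ℚ.* ε) {{δ-pos}} , bound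
  where
  instance
    _ = B-pos
    _ = ℚ.pos⇒nonZero B
  1/B : ℚ
  1/B = 1/ B
  δ-pos : Positive (1/B ℚ.* ε)
  δ-pos = ℚ.pos*pos⇒pos 1/B {{ℚ.1/pos⇒pos B}} ε {{positive 0<ε}}
  bound : ∀ a b → ∣ a ∣ ℚ.≤ B → ∣ b ∣ ℚ.< 1/B ℚ.* ε → ∣ a ℚ.* b ∣ ℚ.< ε
  bound a b a≤B b<δ = begin-strict
    ∣ a ℚ.* b ∣           ≡⟨ ℚ.∣p*q∣≡∣p∣*∣q∣ a b ⟩
    ∣ a ∣ ℚ.* ∣ b ∣       ≤⟨ ℚ.*-monoʳ-≤-nonNeg ∣ b ∣ {{ℚ.∣-∣-nonNeg b}} a≤B ⟩
    B ℚ.* ∣ b ∣           <⟨ ℚ.*-monoʳ-<-pos B b<δ ⟩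
    B ℚ.* (1/B ℚ.* ε)     ≡⟨ ℚ.*-assoc B 1/B ε ⟨
    (B ℚ.* 1/B) ℚ.* ε     ≡⟨ cong (ℚ._* ε) (ℚ.*-inverseʳ B) ⟩
    1ℚ ℚ.* ε              ≡⟨ ℚ.*-identityˡ ε ⟩
    ε                     ∎
    where open ℚ.≤-Reasoning

*-cauchy : ∀ {x y} → IsCauchy x → IsCauchy y → IsCauchy (λ n → x n ℚ.* y n)
*-cauchy {x} {y} cx cy ε 0<ε =
  let
    (B , B-pos , N₁ , x≤B) = cauchy-bounded cx
    (C , C-pos , N₂ , y≤C) = cauchy-bounded cy
    (δ , 0<δ , f) = small-factor B B-pos (½ ℚ.* ε) (half-pos 0<ε)
    (γ , 0<γ , g) = small-factor C C-pos (½ ℚ.* ε) (half-pos 0<ε)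
    (N₃ , p) = cy δ 0<δ
    (N₄ , q) = cx γ 0<γ
    left : ∀ {k} → (N₁ ⊔ N₂) ⊔ (N₃ ⊔ N₄) ℕ.≤ k → N₁ ⊔ N₂ ℕ.≤ k
    left = ℕ.m⊔n≤o⇒m≤o (N₁ ⊔ N₂) (N₃ ⊔ N₄)
    right : ∀ {k} → (N₁ ⊔ N₂) ⊔ (N₃ ⊔ N₄) ℕ.≤ k → N₃ ⊔ N₄ ℕ.≤ k
    right = ℕ.m⊔n≤o⇒n≤o (N₁ ⊔ N₂) (N₃ ⊔ N₄)
  in (N₁ ⊔ N₂) ⊔ (N₃ ⊔ N₄) , λ m n ≤m ≤n → estimate (x m) (y m) (x n) (y n)
    (f (x m) (y m ℚ.- y n)
      (x≤B m (ℕ.m⊔n≤o⇒m≤o N₁ N₂ (left ≤m)))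
      (p m n (ℕ.m⊔n≤o⇒m≤o N₃ N₄ (right ≤m)) (ℕ.m⊔n≤o⇒m≤o N₃ N₄ (right ≤n))))
    (g (y n) (x m ℚ.- x n)
      (y≤C n (ℕ.m⊔n≤o⇒n≤o N₁ N₂ (left ≤n)))
      (q m n (ℕ.m⊔n≤o⇒n≤o N₃ N₄ (right ≤m)) (ℕ.m⊔n≤o⇒n≤o N₃ N₄ (right ≤n))))
  where
  open ℚ.≤-Reasoning
  regroup : ∀ a b c d →
    a ℚ.* b ℚ.- c ℚ.* d ≡ a ℚ.* (b ℚ.- d) ℚ.+ d ℚ.* (a ℚ.- c)
  regroup = solve 4 (λ a b c d → a :* b :- c :* d := a :* (b :- d) :+ d :* (a :- c)) refl
    where open +-*-Solver
  estimate : ∀ a b c d →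
    ∣ a ℚ.* (b ℚ.- d) ∣ ℚ.< ½ ℚ.* ε → ∣ d ℚ.* (a ℚ.- c) ∣ ℚ.< ½ ℚ.* ε →
    ∣ a ℚ.* b ℚ.- c ℚ.* d ∣ ℚ.< ε
  estimate a b c d h₁ h₂ = begin-strict
    ∣ a ℚ.* b ℚ.- c ℚ.* d ∣
      ≡⟨ cong ∣_∣ (regroup a b c d) ⟩
    ∣ a ℚ.* (b ℚ.- d) ℚ.+ d ℚ.* (a ℚ.- c) ∣
      ≤⟨ ℚ.∣p+q∣≤∣p∣+∣q∣ (a ℚ.* (b ℚ.- d)) (d ℚ.* (a ℚ.- c)) ⟩
    ∣ a ℚ.* (b ℚ.- d) ∣ ℚ.+ ∣ d ℚ.* (a ℚ.- c) ∣
      <⟨ ℚ.+-mono-< h₁ h₂ ⟩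
    ½ ℚ.* ε ℚ.+ ½ ℚ.* ε
      ≡⟨ halves ε ⟩
    ε ∎

fromℚ : ℚ → ℝ
fromℚ q = mkℝ (λ _ → q) (const-cauchy q)

fromℤ : ℤ → ℝ
fromℤ i = fromℚ (i / 1)

0ℝ 1ℝ : ℝ
0ℝ = fromℚ 0ℚ
1ℝ = fromℚ 1ℚ

infix  8 -_
infixl 7 _*_
infixl 6 _+_ _-_

_+_ : ℝ → ℝ → ℝ
x + y = mkℝ (λ n → seq x n ℚ.+ seq y n) (+-cauchy {seq x} {seq y} (cauchy x) (cauchy y))

_*_ : ℝ → ℝ → ℝ
x * y = mkℝ (λ n → seq x n ℚ.* seq y n) (*-cauchy {seq x} {seq y} (cauchy x) (cauchy y))

-_ : ℝ → ℝ
- x = mkℝ (λ n → ℚ.- seq x n) (neg-cauchy {seq x} (cauchy x))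

_-_ : ℝ → ℝ → ℝ
x - y = x + (- y)

∑ : ∀ {A : Set} → List A → (A → ℝ) → ℝ
∑ xs f = foldr _+_ 0ℝ (map f xs)

∏ : ∀ {A : Set} → List A → (A → ℝ) → ℝ
∏ xs f = foldr _*_ 1ℝ (map f xs)

infix 5 ∑ ∏

syntax ∑ xs (λ x → e) = ∑[ x ∈ xs ] e
syntax ∏ xs (λ x → e) = ∏[ x ∈ xs ] e

allExcept : ∀ {n} → Fin n → List (Fin n)
allExcept {n} i = filter (λ j → ¬? (j Fin.≟ i)) (allFin n)

-- An arithmetic function is taken on all of ℕ, but only its values
-- at positive arguments are meaningful.

divisors : ℕ → List ℕ
divisors m = filter (_∣? m) (applyUpTo suc m)

-- (1 * f)(m), the Dirichlet convolution of f with the constant function 1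
1⋆ : (ℕ → ℝ) → ℕ → ℝ
1⋆ f m = ∑[ k ∈ divisors m ] f k

-- The Möbius function: (-1)^r on a product of r distinct primes, and
-- 0 on a number having a repeated prime factor.
möbius : ℕ → ℤ
möbius zero      = 0ℤ
möbius m@(suc _) = if does (unique? ℕ._≟_ ps) then -1ℤ ℤ.^ length ps else 0ℤ
  where
  ps : List ℕ
  ps = factors (factorise m)

μ : ℕ → ℝ
μ m = fromℤ (möbius m)

module Submission where

-- Write d i, a i, b i for the divisor sums of μ, λ⁻ i, λ⁺ i at m i.  Since 0 ≤ d i (the
-- divisor sum of μ is 1 or 0), a i ≤ d i and d i ≤ b i, the difference of the
-- two sides is nonnegative by induction on the index set: adding an index x
-- to xs multiplies the difference by b x and adds the nonnegative terms
-- (d x - a x) ∏ b and (b x - d x) (∏ b - ∏ d).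
--
-- The divisors of p q, p prime, are the divisors of q prime to p together with
-- the products p k, k ∣ q.  As μ (p k) is - μ k or 0 according to whether k is
-- prime to p, the divisor sum of μ at p q cancels.

open import Defs
open import Data.Bool.Base using (if_then_else_)
open import Data.Fin.Base using (Fin)
import Data.Fin.Properties as Fin
open import Data.Integer.Base as ℤ using (ℤ; +_; 0ℤ; 1ℤ; -1ℤ)
import Data.Integer.Properties as ℤ
open import Data.List.Base using (List; []; _∷_; _++_; allFin; applyUpTo; filter; foldr; length; map)
open import Data.List.Membership.Propositional using (_∈_; _∉_)
open import Data.List.Membership.Propositional.Properties
  using (∈-++⁺ˡ; ∈-++⁺ʳ; ∈-++⁻; ∈-applyUpTo⁺; ∈-applyUpTo⁻; ∈-filter⁺; ∈-filter⁻; ∈-map⁺; ∈-map⁻)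
open import Data.List.Membership.Propositional.Properties.WithK using (unique∧set⇒bag)
open import Data.List.Properties
  using (filter-accept; filter-all; filter-reject; length-tabulate; map-++)
open import Data.List.Relation.Binary.BagAndSetEquality using (∼bag⇒↭)
open import Data.List.Relation.Binary.Permutation.Propositional
  using (_↭_; ↭-sym; ↭⇒↭ₛ)
open import Data.List.Relation.Binary.Permutation.Propositional.Properties
  using (↭-length)
  renaming (map⁺ to ↭-map⁺)
import Data.List.Relation.Binary.Permutation.Setoid.Properties as Permutation
open import Data.List.Relation.Unary.All as All using (All; []; _∷_)
open import Data.List.Relation.Unary.All.Properties using (¬Any⇒All¬)
open import Data.List.Relation.Unary.AllPairs using ([]; _∷_)
open import Data.List.Relation.Unary.Unique.DecPropositional using (unique?)
open import Data.List.Relation.Unary.Unique.Propositional using (Unique)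
open import Data.List.Relation.Unary.Unique.Propositional.Properties
  using (allFin⁺; applyUpTo⁺₁; filter⁺; map⁺; ++⁺; Unique[x∷xs]⇒x∉xs)
open import Data.Nat.Base as ℕ using (ℕ; suc; NonZero; _∸_; _⊔_)
import Data.Nat.Properties as ℕ
open import Data.Nat.Coprimality using (coprime-divisor)
open import Data.Nat.Divisibility
  using (_∣_; _∤_; _∣?_; divides; ∣-trans; ∣⇒≤; m∣m*n; n∣m*n; *-monoʳ-∣; *-cancelˡ-∣)
open import Data.Nat.ListAction using (product)
open import Data.Nat.ListAction.Properties using (∈⇒∣product)
open import Data.Nat.Primality using (Prime; prime⇒irreducible; prime⇒nonZero; productOfPrimes≢0)
open import Data.Nat.Primality.Factorisation
  using (PrimeFactorisation; factorise; factors; factorisationUnique; factorisationHasAllPrimeFactors)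
open import Data.Product.Base using (_×_; _,_; proj₁; proj₂)
open import Data.Rational.Base as ℚ using (0ℚ; 1ℚ; ½; _/_)
import Data.Rational.Properties as ℚ
open import Data.Rational.Solver using (module +-*-Solver)
import Data.Rational.Unnormalised.Base as ℚᵘ
import Data.Rational.Unnormalised.Properties as ℚᵘ
open import Data.Sum.Base using (inj₁; inj₂)
open import Function.Base using (_∘_)
open import Function.Bundles using (mk⇔)
open import Relation.Binary.Definitions using (DecidableEquality)
open import Relation.Binary.PropositionalEquality
  using (_≡_; _≢_; refl; sym; trans; cong; cong₂; subst; setoid; module ≡-Reasoning)
open import Relation.Nullary.Decidable using (Dec; yes; no; does; ¬?; does-⇔; dec-true; dec-false)
open import Relation.Nullary.Negation using (¬_; contradiction)

open PrimeFactorisation using (isFactorisation; factorsPrime)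

-- Ordered ring structure of the Cauchy reals

infix 4 _≈_

-- Finer than equality of real numbers. The ring operations act termwise, so the polynomial
-- identities used below already hold in this sense and are left to the rational ring solver.
_≈_ : ℝ → ℝ → Set
x ≈ y = ∀ n → seq x n ≡ seq y n

0≤-resp-≈ : ∀ {x y} → x ≈ y → 0ℝ ≤ x → 0ℝ ≤ y
0≤-resp-≈ x≈y 0≤x ε 0<ε with 0≤x ε 0<ε
... | N , p = N , λ n N≤n → subst (λ z → 0ℚ ℚ.≤ z ℚ.+ ε) (x≈y n) (p n N≤n)

0≤fromℚ : ∀ {q} → 0ℚ ℚ.≤ q → 0ℝ ≤ fromℚ q
0≤fromℚ 0≤q ε 0<ε = 0 , λ _ _ → ℚ.+-mono-≤ 0≤q (ℚ.<⇒≤ 0<ε)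

x≤y⇒0≤y-x : ∀ {x y} → x ≤ y → 0ℝ ≤ y - x
x≤y⇒0≤y-x {x} {y} x≤y ε 0<ε with x≤y ε 0<ε
... | N , p = N , λ n N≤n → begin
  0ℚ                                 ≡⟨ ℚ.+-inverseʳ (seq x n) ⟨
  seq x n ℚ.- seq x n                ≤⟨ ℚ.+-monoˡ-≤ (ℚ.- seq x n) (p n N≤n) ⟩
  (seq y n ℚ.+ ε) ℚ.- seq x n        ≡⟨ regroup (seq x n) (seq y n) ε ⟩
  (seq y n ℚ.- seq x n) ℚ.+ ε        ∎
  where
  open ℚ.≤-Reasoning
  regroup : ∀ x y ε → (y ℚ.+ ε) ℚ.- x ≡ (y ℚ.- x) ℚ.+ ε
  regroup = solve 3 (λ x y ε → (y :+ ε) :- x := (y :- x) :+ ε) refl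
    where open +-*-Solver

0≤y-x⇒x≤y : ∀ {x y} → 0ℝ ≤ y - x → x ≤ y
0≤y-x⇒x≤y {x} {y} 0≤y-x ε 0<ε with 0≤y-x ε 0<ε
... | N , p = N , λ n N≤n → begin
  seq x n                                     ≡⟨ ℚ.+-identityˡ (seq x n) ⟨
  0ℚ ℚ.+ seq x n                              ≤⟨ ℚ.+-monoˡ-≤ (seq x n) (p n N≤n) ⟩
  ((seq y n ℚ.- seq x n) ℚ.+ ε) ℚ.+ seq x n   ≡⟨ regroup (seq x n) (seq y n) ε ⟩
  seq y n ℚ.+ ε                               ∎
  where
  open ℚ.≤-Reasoning
  regroup : ∀ x y ε → ((y ℚ.- x) ℚ.+ ε) ℚ.+ x ≡ y ℚ.+ ε
  regroup = solve 3 (λ x y ε → ((y :- x) :+ ε) :+ x := y :+ ε) refl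
    where open +-*-Solver

≤-refl : ∀ {x} → x ≤ x
≤-refl {x} ε 0<ε = 0 , λ n _ →
  subst (ℚ._≤ seq x n ℚ.+ ε) (ℚ.+-identityʳ (seq x n)) (ℚ.+-monoʳ-≤ (seq x n) (ℚ.<⇒≤ 0<ε))

≤-trans : ∀ {x y z} → x ≤ y → y ≤ z → x ≤ z
≤-trans {x} {y} {z} x≤y y≤z ε 0<ε
  with x≤y (½ ℚ.* ε) (half-pos 0<ε) | y≤z (½ ℚ.* ε) (half-pos 0<ε)
... | M , p | N , q = M ⊔ N , λ n ≤n → begin
  seq x n                               ≤⟨ p n (ℕ.m⊔n≤o⇒m≤o M N ≤n) ⟩
  seq y n ℚ.+ ½ ℚ.* ε                   ≤⟨ ℚ.+-monoˡ-≤ (½ ℚ.* ε) (q n (ℕ.m⊔n≤o⇒n≤o M N ≤n)) ⟩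
  (seq z n ℚ.+ ½ ℚ.* ε) ℚ.+ ½ ℚ.* ε     ≡⟨ ℚ.+-assoc (seq z n) (½ ℚ.* ε) (½ ℚ.* ε) ⟩
  seq z n ℚ.+ (½ ℚ.* ε ℚ.+ ½ ℚ.* ε)     ≡⟨ cong (seq z n ℚ.+_) (halves ε) ⟩
  seq z n ℚ.+ ε                         ∎
  where open ℚ.≤-Reasoning

+-nonneg : ∀ {x y} → 0ℝ ≤ x → 0ℝ ≤ y → 0ℝ ≤ x + y
+-nonneg {x} {y} 0≤x 0≤y ε 0<ε
  with 0≤x (½ ℚ.* ε) (half-pos 0<ε) | 0≤y (½ ℚ.* ε) (half-pos 0<ε)
... | M , p | N , q = M ⊔ N , λ n ≤n → begin
  0ℚ                                                  ≤⟨ ℚ.+-mono-≤ (p n (ℕ.m⊔n≤o⇒m≤o M N ≤n)) (q n (ℕ.m⊔n≤o⇒n≤o M N ≤n)) ⟩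
  (seq x n ℚ.+ ½ ℚ.* ε) ℚ.+ (seq y n ℚ.+ ½ ℚ.* ε)     ≡⟨ regroup (seq x n) (seq y n) (½ ℚ.* ε) ⟩
  (seq x n ℚ.+ seq y n) ℚ.+ (½ ℚ.* ε ℚ.+ ½ ℚ.* ε)     ≡⟨ cong ((seq x n ℚ.+ seq y n) ℚ.+_) (halves ε) ⟩
  (seq x n ℚ.+ seq y n) ℚ.+ ε                         ∎
  where
  open ℚ.≤-Reasoning
  regroup : ∀ x y η → (x ℚ.+ η) ℚ.+ (y ℚ.+ η) ≡ (x ℚ.+ y) ℚ.+ (η ℚ.+ η)
  regroup = solve 3 (λ x y η → (x :+ η) :+ (y :+ η) := (x :+ y) :+ (η :+ η)) refl
    where open +-*-Solver

-p≤∣p∣ : ∀ p → ℚ.- p ℚ.≤ ℚ.∣ p ∣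
-p≤∣p∣ p with ℚ.≤-total 0ℚ p
... | inj₁ 0≤p = ℚ.≤-trans (ℚ.neg-antimono-≤ 0≤p) (ℚ.0≤∣p∣ p)
... | inj₂ p≤0 = ℚ.≤-reflexive (sym (trans (sym (ℚ.∣-p∣≡∣p∣ p)) (ℚ.0≤p⇒∣p∣≡p (ℚ.neg-antimono-≤ p≤0))))

∣p∣<ε⇒0≤p+ε : ∀ {p ε} → ℚ.∣ p ∣ ℚ.< ε → 0ℚ ℚ.≤ p ℚ.+ ε
∣p∣<ε⇒0≤p+ε {p} {ε} ∣p∣<ε = begin
  0ℚ              ≡⟨ ℚ.+-inverseʳ p ⟨
  p ℚ.- p         ≤⟨ ℚ.+-monoʳ-≤ p (-p≤∣p∣ p) ⟩
  p ℚ.+ ℚ.∣ p ∣     ≤⟨ ℚ.+-monoʳ-≤ p (ℚ.<⇒≤ ∣p∣<ε) ⟩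
  p ℚ.+ ε         ∎
  where open ℚ.≤-Reasoning

-- A nonnegative real may be represented by negative terms, but only by small ones. The tolerance is
-- halved because `small-factor` asks for a strict bound.
0≤p+½δ∧p≤0⇒∣p∣<δ : ∀ {p δ} → 0ℚ ℚ.< δ → 0ℚ ℚ.≤ p ℚ.+ ½ ℚ.* δ → p ℚ.≤ 0ℚ → ℚ.∣ p ∣ ℚ.< δ
0≤p+½δ∧p≤0⇒∣p∣<δ {p} {δ} 0<δ 0≤p+½δ p≤0 = begin-strict
  ℚ.∣ p ∣                         ≡⟨ ℚ.∣-p∣≡∣p∣ p ⟨
  ℚ.∣ ℚ.- p ∣                     ≡⟨ ℚ.0≤p⇒∣p∣≡p (ℚ.neg-antimono-≤ p≤0) ⟩
  ℚ.- p                         ≡⟨ ℚ.+-identityʳ (ℚ.- p) ⟨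
  ℚ.- p ℚ.+ 0ℚ                  ≤⟨ ℚ.+-monoʳ-≤ (ℚ.- p) 0≤p+½δ ⟩
  ℚ.- p ℚ.+ (p ℚ.+ ½ ℚ.* δ)     ≡⟨ regroup p (½ ℚ.* δ) ⟩
  0ℚ ℚ.+ ½ ℚ.* δ                <⟨ ℚ.+-monoˡ-< (½ ℚ.* δ) (half-pos 0<δ) ⟩
  ½ ℚ.* δ ℚ.+ ½ ℚ.* δ           ≡⟨ halves δ ⟩
  δ                             ∎
  where
  open ℚ.≤-Reasoning
  regroup : ∀ p η → ℚ.- p ℚ.+ (p ℚ.+ η) ≡ 0ℚ ℚ.+ η
  regroup = solve 2 (λ p η → :- p :+ (p :+ η) := con 0ℚ :+ η) refl
    where open +-*-Solver

-- Far out in the sequences, if one factor of a term is nonpositive, it is close to 0 while the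
-- other is bounded, so the product is below `ε` in absolute value. Otherwise both factors are
-- nonnegative and so is the product.
*-nonneg : ∀ {x y} → 0ℝ ≤ x → 0ℝ ≤ y → 0ℝ ≤ x * y
*-nonneg {x} {y} 0≤x 0≤y ε 0<ε =
  let
    (B , B-pos , N₁ , x≤B) = cauchy-bounded (cauchy x)
    (C , C-pos , N₂ , y≤C) = cauchy-bounded (cauchy y)
    -- `B` bounds the terms of `x`, so `δ` is the tolerance for `y`; `C` and `γ` serve with the
    -- roles exchanged.
    (δ , 0<δ , f) = small-factor B B-pos ε 0<ε
    (γ , 0<γ , g) = small-factor C C-pos ε 0<ε
    (N₃ , p) = 0≤y (½ ℚ.* δ) (half-pos 0<δ)
    (N₄ , q) = 0≤x (½ ℚ.* γ) (half-pos 0<γ)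
    left : ∀ {k} → (N₁ ⊔ N₂) ⊔ (N₃ ⊔ N₄) ℕ.≤ k → N₁ ⊔ N₂ ℕ.≤ k
    left = ℕ.m⊔n≤o⇒m≤o (N₁ ⊔ N₂) (N₃ ⊔ N₄)
    right : ∀ {k} → (N₁ ⊔ N₂) ⊔ (N₃ ⊔ N₄) ℕ.≤ k → N₃ ⊔ N₄ ℕ.≤ k
    right = ℕ.m⊔n≤o⇒n≤o (N₁ ⊔ N₂) (N₃ ⊔ N₄)
  in (N₁ ⊔ N₂) ⊔ (N₃ ⊔ N₄) , λ n ≤n → cases (seq x n) (seq y n)
    (λ y≤0 → f (seq x n) (seq y n) (x≤B n (ℕ.m⊔n≤o⇒m≤o N₁ N₂ (left ≤n)))
      (0≤p+½δ∧p≤0⇒∣p∣<δ 0<δ (p n (ℕ.m⊔n≤o⇒m≤o N₃ N₄ (right ≤n))) y≤0))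
    (λ x≤0 → g (seq y n) (seq x n) (y≤C n (ℕ.m⊔n≤o⇒n≤o N₁ N₂ (left ≤n)))
      (0≤p+½δ∧p≤0⇒∣p∣<δ 0<γ (q n (ℕ.m⊔n≤o⇒n≤o N₃ N₄ (right ≤n))) x≤0))
  where
  cases : ∀ a b → (b ℚ.≤ 0ℚ → ℚ.∣ a ℚ.* b ∣ ℚ.< ε) → (a ℚ.≤ 0ℚ → ℚ.∣ b ℚ.* a ∣ ℚ.< ε) →
    0ℚ ℚ.≤ a ℚ.* b ℚ.+ ε
  cases a b small-b small-a with ℚ.≤-total b 0ℚ | ℚ.≤-total a 0ℚ
  ... | inj₁ b≤0 | _        = ∣p∣<ε⇒0≤p+ε (small-b b≤0)
  ... | inj₂ _   | inj₁ a≤0 =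
    ∣p∣<ε⇒0≤p+ε (subst (λ z → ℚ.∣ z ∣ ℚ.< ε) (ℚ.*-comm b a) (small-a a≤0))
  ... | inj₂ 0≤b | inj₂ 0≤a = ℚ.+-mono-≤ 0≤ab (ℚ.<⇒≤ 0<ε)
    where
    0≤ab : 0ℚ ℚ.≤ a ℚ.* b
    0≤ab = subst (ℚ._≤ a ℚ.* b) (ℚ.*-zeroˡ b) (ℚ.*-monoʳ-≤-nonNeg b {{ℚ.nonNegative 0≤b}} 0≤a)

-- `_/_` reduces fractions to lowest terms, so the two sides do not compute to one another for
-- variable `i` and `j`. The comparison is made with unnormalised fractions, all of denominator 1.
/1-homo-+ : ∀ i j → (i ℤ.+ j) / 1 ≡ i / 1 ℚ.+ j / 1
/1-homo-+ i j = ℚ.toℚᵘ-injective (begin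
  ℚ.toℚᵘ ((i ℤ.+ j) / 1)                    ≈⟨ ℚ.toℚᵘ-fromℚᵘ (ℚᵘ.mkℚᵘ (i ℤ.+ j) 0) ⟩
  ℚᵘ.mkℚᵘ (i ℤ.+ j) 0                       ≡⟨ cong (λ k → ℚᵘ.mkℚᵘ k 0) (cong₂ ℤ._+_ (ℤ.*-identityʳ i) (ℤ.*-identityʳ j)) ⟨
  ℚᵘ.mkℚᵘ i 0 ℚᵘ.+ ℚᵘ.mkℚᵘ j 0              ≈⟨ ℚᵘ.+-cong (ℚ.toℚᵘ-fromℚᵘ (ℚᵘ.mkℚᵘ i 0)) (ℚ.toℚᵘ-fromℚᵘ (ℚᵘ.mkℚᵘ j 0)) ⟨
  ℚ.toℚᵘ (i / 1) ℚᵘ.+ ℚ.toℚᵘ (j / 1)        ≈⟨ ℚ.toℚᵘ-homo-+ (i / 1) (j / 1) ⟨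
  ℚ.toℚᵘ (i / 1 ℚ.+ j / 1)                  ∎)
  where open ℚᵘ.≃-Reasoning

-- The product inequality

-- The hypothesis concerns only the entries of the list because `mixed-∷` can supply it only for
-- indices distinct from the one being added.
∑-distribˡ : ∀ {A : Set} {f g : A → ℝ} c {xs} →
  All (λ i → f i ≈ c * g i) xs → ∑ xs f ≈ c * ∑ xs g
∑-distribˡ c []                 n = sym (ℚ.*-zeroʳ (seq c n))
∑-distribˡ {g = g} c {x ∷ xs} (e ∷ es) n =
  trans (cong₂ ℚ._+_ (e n) (∑-distribˡ c es n))
        (sym (ℚ.*-distribˡ-+ (seq c n) (seq (g x) n) (seq (∑ xs g) n)))

∑-cong : ∀ {A : Set} {f g : A → ℝ} → (∀ i → f i ≈ g i) → ∀ xs → ∑ xs f ≈ ∑ xs g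
∑-cong f≈g []       n = refl
∑-cong f≈g (x ∷ xs) n = cong₂ ℚ._+_ (f≈g x n) (∑-cong f≈g xs n)

module _ {A : Set} (_≟_ : DecidableEquality A) where

  -- Generalises `allExcept` from `allFin n` to any list, so that the induction can run over index
  -- lists.
  without : A → List A → List A
  without i = filter (λ j → ¬? (j ≟ i))

  without-here : ∀ {x xs} → x ∉ xs → without x (x ∷ xs) ≡ xs
  without-here {x} {xs} x∉xs = trans
    (filter-reject (λ j → ¬? (j ≟ x)) (λ x≢x → x≢x refl))
    (filter-all (λ j → ¬? (j ≟ x)) (All.map (_∘ sym) (¬Any⇒All¬ xs x∉xs)))

  module _ (a b : A → ℝ) where

    mixed : List A → ℝ
    mixed xs = ∑[ i ∈ xs ] (a i * (∏[ j ∈ without i xs ] b j))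

    -- The summand at `x` omits `b x` and keeps the full product over `xs`. Every other summand
    -- gains the factor `b x`, which is pulled out of the sum.
    mixed-∷ : ∀ {x xs} → Unique (x ∷ xs) →
      mixed (x ∷ xs) ≈ a x * ∏ xs b + b x * mixed xs
    mixed-∷ {x} {xs} u@(x≢xs ∷ _) n = cong₂ ℚ._+_
      (cong (λ ys → seq (a x * ∏ ys b) n) (without-here (Unique[x∷xs]⇒x∉xs u)))
      (∑-distribˡ (b x) (All.map pull x≢xs) n)
      where
      pull : ∀ {i} → x ≢ i →
        a i * ∏ (without i (x ∷ xs)) b ≈ b x * (a i * ∏ (without i xs) b)
      pull {i} x≢i n = trans
        (cong (λ ys → seq (a i * ∏ ys b) n) (filter-accept (λ j → ¬? (j ≟ i)) x≢i))
        (swap (seq (a i) n) (seq (b x) n) (seq (∏ (without i xs) b) n))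
        where
        swap : ∀ a b p → a ℚ.* (b ℚ.* p) ≡ b ℚ.* (a ℚ.* p)
        swap = solve 3 (λ a b p → a :* (b :* p) := b :* (a :* p)) refl
          where open +-*-Solver

  module _ (a d b : A → ℝ)
    (0≤d : ∀ i → 0ℝ ≤ d i) (a≤d : ∀ i → a i ≤ d i) (d≤b : ∀ i → d i ≤ b i) where

    private
      E : List A → ℝ
      E = mixed a b

    0≤b : ∀ i → 0ℝ ≤ b i
    0≤b i = ≤-trans {0ℝ} {d i} {b i} (0≤d i) (d≤b i)

    0≤∏d : ∀ xs → 0ℝ ≤ ∏ xs d
    0≤∏d []       = 0≤fromℚ (ℚ.nonNegative⁻¹ 1ℚ)
    0≤∏d (x ∷ xs) = *-nonneg {d x} {∏ xs d} (0≤d x) (0≤∏d xs)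

    -- Telescoping: with `B` and `D` the products over the tail, b B - d D = b (B - D) + (b - d) D.
    0≤∏b-∏d : ∀ xs → 0ℝ ≤ ∏ xs b - ∏ xs d
    0≤∏b-∏d []       = x≤y⇒0≤y-x {1ℝ} {1ℝ} (≤-refl {1ℝ})
    0≤∏b-∏d (x ∷ xs) = 0≤-resp-≈ {s} {∏ (x ∷ xs) b - ∏ (x ∷ xs) d}
      (λ n → regroup (seq (b x) n) (seq (d x) n) (seq (∏ xs b) n) (seq (∏ xs d) n))
      (+-nonneg {b x * (∏ xs b - ∏ xs d)} {(b x - d x) * ∏ xs d}
        (*-nonneg {b x} {∏ xs b - ∏ xs d} (0≤b x) (0≤∏b-∏d xs))
        (*-nonneg {b x - d x} {∏ xs d} (x≤y⇒0≤y-x {d x} {b x} (d≤b x)) (0≤∏d xs)))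
      where
      s : ℝ
      s = b x * (∏ xs b - ∏ xs d) + (b x - d x) * ∏ xs d
      regroup : ∀ b d B D →
        b ℚ.* (B ℚ.- D) ℚ.+ (b ℚ.- d) ℚ.* D ≡ b ℚ.* B ℚ.- d ℚ.* D
      regroup = solve 4 (λ b d B D →
        b :* (B :- D) :+ (b :- d) :* D := b :* B :- d :* D) refl
        where open +-*-Solver

    0≤∏b : ∀ xs → 0ℝ ≤ ∏ xs b
    0≤∏b []       = 0≤fromℚ (ℚ.nonNegative⁻¹ 1ℚ)
    0≤∏b (x ∷ xs) = *-nonneg {b x} {∏ xs b} (0≤b x) (0≤∏b xs)

    -- The coefficient is formed by subtraction in `ℝ`, so it is -1 on the empty list. The gap there
    -- is 1 - (0 - (-1)) = 0, and the recurrence holds from the first index added.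
    gap : List A → ℝ
    gap xs = ∏ xs d - (E xs - (fromℤ (+ length xs) - 1ℝ) * ∏ xs b)

    0≤gap : ∀ {xs} → Unique xs → 0ℝ ≤ gap xs
    0≤gap {[]}     _          = 0≤-resp-≈ {0ℝ} {gap []} (λ _ → refl) (≤-refl {0ℝ})
    0≤gap {x ∷ xs} u@(_ ∷ us) = 0≤-resp-≈ {s} {gap (x ∷ xs)} s≈gap
      (+-nonneg {b x * gap xs + (d x - a x) * ∏ xs b} {(b x - d x) * (∏ xs b - ∏ xs d)}
        (+-nonneg {b x * gap xs} {(d x - a x) * ∏ xs b}
          (*-nonneg {b x} {gap xs} (0≤b x) (0≤gap us))
          (*-nonneg {d x - a x} {∏ xs b} (x≤y⇒0≤y-x {a x} {d x} (a≤d x)) (0≤∏b xs)))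
        (*-nonneg {b x - d x} {∏ xs b - ∏ xs d} (x≤y⇒0≤y-x {d x} {b x} (d≤b x)) (0≤∏b-∏d xs)))
      where
      s : ℝ
      s = (b x * gap xs + (d x - a x) * ∏ xs b) + (b x - d x) * (∏ xs b - ∏ xs d)
      regroup : ∀ a b d B D E L →
        (b ℚ.* (D ℚ.- (E ℚ.- (L ℚ.- 1ℚ) ℚ.* B)) ℚ.+ (d ℚ.- a) ℚ.* B) ℚ.+ (b ℚ.- d) ℚ.* (B ℚ.- D)
          ≡ d ℚ.* D ℚ.- ((a ℚ.* B ℚ.+ b ℚ.* E) ℚ.- ((1ℚ ℚ.+ L) ℚ.- 1ℚ) ℚ.* (b ℚ.* B))
      regroup = solve 7 (λ a b d B D E L →
        (b :* (D :- (E :- (L :- con 1ℚ) :* B)) :+ (d :- a) :* B) :+ (b :- d) :* (B :- D)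
          := d :* D :- ((a :* B :+ b :* E) :- ((con 1ℚ :+ L) :- con 1ℚ) :* (b :* B))) refl
        where open +-*-Solver
      s≈gap : s ≈ gap (x ∷ xs)
      s≈gap n = trans
        (regroup (seq (a x) n) (seq (b x) n) (seq (d x) n)
          (seq (∏ xs b) n) (seq (∏ xs d) n) (seq (E xs) n) ((+ length xs) / 1))
        -- The solver leaves the mixed sum of `x ∷ xs` expanded and its length as 1 + L; both are
        -- now folded back.
        (cong₂ (λ E L → seq (∏ (x ∷ xs) d) n ℚ.- (E ℚ.- (L ℚ.- 1ℚ) ℚ.* seq (∏ (x ∷ xs) b) n))
          (sym (mixed-∷ a b u n)) (sym (/1-homo-+ 1ℤ (+ length xs))))

    -- The list without i is a parameter: letting the type checker identify two
    -- forms of it inside a real number makes it compare Cauchy proofs.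
    ∑-[n-1]∏≤∏ : ∀ xs k (others : A → List A) → (∀ i → others i ≡ without i xs) →
      Unique xs → length xs ≡ suc k →
      (∑[ i ∈ xs ] (a i * (∏[ j ∈ others i ] b j))) - fromℤ (+ k) * (∏[ i ∈ xs ] b i)
        ≤ (∏[ i ∈ xs ] d i)
    ∑-[n-1]∏≤∏ xs k others others≡without u length≡1+k =
      0≤y-x⇒x≤y {E′ - fromℤ (+ k) * ∏ xs b} {∏ xs d}
      (0≤-resp-≈ {gap xs} {∏ xs d - (E′ - fromℤ (+ k) * ∏ xs b)}
        (λ n → cong₂ (λ E L → seq (∏ xs d) n ℚ.- (E ℚ.- L ℚ.* seq (∏ xs b) n))
          (∑-cong (λ i n → cong (λ ys → seq (a i * ∏ ys b) n) (sym (others≡without i))) xs n)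
          length-1≡k)
        (0≤gap u))
      where
      E′ : ℝ
      E′ = ∑[ i ∈ xs ] (a i * (∏[ j ∈ others i ] b j))
      length-1≡k : (+ length xs) / 1 ℚ.- 1ℚ ≡ (+ k) / 1
      length-1≡k = begin
        (+ length xs) / 1 ℚ.- 1ℚ       ≡⟨ cong (λ l → (+ l) / 1 ℚ.- 1ℚ) length≡1+k ⟩
        (+ suc k) / 1 ℚ.- 1ℚ           ≡⟨ cong (ℚ._- 1ℚ) (/1-homo-+ 1ℤ (+ k)) ⟩
        (1ℚ ℚ.+ (+ k) / 1) ℚ.- 1ℚ      ≡⟨ cancel ((+ k) / 1) ⟩
        (+ k) / 1                      ∎
        where
        open ≡-Reasoning
        cancel : ∀ q → (1ℚ ℚ.+ q) ℚ.- 1ℚ ≡ q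
        cancel = solve 1 (λ q → (con 1ℚ :+ q) :- con 1ℚ := q) refl
          where open +-*-Solver

-- Divisor sums of the Möbius function

-- The body of `möbius` with the list of primes as an argument, so that it can be evaluated on any
-- factorisation and not only on the one computed by `factorise`.
squarefreeSign : List ℕ → ℤ
squarefreeSign ps = if does (unique? ℕ._≟_ ps) then -1ℤ ℤ.^ length ps else 0ℤ

squarefreeSign-↭ : ∀ {ps qs} → ps ↭ qs → squarefreeSign ps ≡ squarefreeSign qs
squarefreeSign-↭ {ps} {qs} ps↭qs = cong₂ (λ c l → if c then -1ℤ ℤ.^ l else 0ℤ)
  (does-⇔ (mk⇔ (Permutation.Unique-resp-↭ (setoid ℕ) (↭⇒↭ₛ ps↭qs))
                (Permutation.Unique-resp-↭ (setoid ℕ) (↭⇒↭ₛ (↭-sym ps↭qs))))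
    (unique? ℕ._≟_ ps) (unique? ℕ._≟_ qs))
  (↭-length ps↭qs)

squarefreeSign-unique : ∀ {ps} → Unique ps → squarefreeSign ps ≡ -1ℤ ℤ.^ length ps
squarefreeSign-unique {ps} u =
  cong (if_then -1ℤ ℤ.^ length ps else 0ℤ) (dec-true (unique? ℕ._≟_ ps) u)

squarefreeSign-¬unique : ∀ {ps} → ¬ Unique ps → squarefreeSign ps ≡ 0ℤ
squarefreeSign-¬unique {ps} ¬u =
  cong (if_then -1ℤ ℤ.^ length ps else 0ℤ) (dec-false (unique? ℕ._≟_ ps) ¬u)

squarefreeSign-∈ : ∀ {p ps} → p ∈ ps → squarefreeSign (p ∷ ps) ≡ 0ℤ
squarefreeSign-∈ {p} {ps} p∈ps = squarefreeSign-¬unique {p ∷ ps} (λ u → Unique[x∷xs]⇒x∉xs u p∈ps)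

squarefreeSign-∉ : ∀ {p ps} → p ∉ ps → squarefreeSign (p ∷ ps) ≡ ℤ.- squarefreeSign ps
squarefreeSign-∉ {p} {ps} p∉ps = by-uniqueness (unique? ℕ._≟_ ps)
  where
  by-uniqueness : Dec (Unique ps) → squarefreeSign (p ∷ ps) ≡ ℤ.- squarefreeSign ps
  by-uniqueness (yes u) = begin
    squarefreeSign (p ∷ ps)      ≡⟨ squarefreeSign-unique {p ∷ ps} (¬Any⇒All¬ ps p∉ps ∷ u) ⟩
    -1ℤ ℤ.* -1ℤ ℤ.^ length ps    ≡⟨ ℤ.-1*i≡-i (-1ℤ ℤ.^ length ps) ⟩
    ℤ.- (-1ℤ ℤ.^ length ps)      ≡⟨ cong ℤ.-_ (squarefreeSign-unique {ps} u) ⟨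
    ℤ.- squarefreeSign ps        ∎
    where open ≡-Reasoning
  by-uniqueness (no ¬u) = trans
    (squarefreeSign-¬unique {p ∷ ps} (λ { (_ ∷ u) → ¬u u }))
    (cong ℤ.-_ (sym (squarefreeSign-¬unique {ps} ¬u)))

-- Prime factorisations are unique up to permutation, which changes neither the length nor the
-- absence of repetitions. Hence the value at `p * k` can be read off from `p` prefixed to the
-- factors of `k`.
möbius≡squarefreeSign : ∀ {m} .{{_ : NonZero m}} (f : PrimeFactorisation m) →
  möbius m ≡ squarefreeSign (factors f)
möbius≡squarefreeSign {suc _} f = squarefreeSign-↭ (factorisationUnique (factorise _) f)

prime-∷ : ∀ {p k} → Prime p → PrimeFactorisation k → PrimeFactorisation (p ℕ.* k)
prime-∷ {p} prime-p f = record
  { factors         = p ∷ factors f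
  ; isFactorisation = cong (p ℕ.*_) (isFactorisation f)
  ; factorsPrime    = prime-p ∷ factorsPrime f
  }

-- Divisors of a prime multiple

∈-divisors⁺ : ∀ {k m} .{{_ : NonZero k}} .{{_ : NonZero m}} → k ∣ m → k ∈ divisors m
∈-divisors⁺ {suc _} {m} k∣m = ∈-filter⁺ (_∣? m) (∈-applyUpTo⁺ suc (∣⇒≤ k∣m)) k∣m

∈-divisors⁻ : ∀ {k} m → k ∈ divisors m → NonZero k × k ∣ m
∈-divisors⁻ m k∈ with ∈-filter⁻ (_∣? m) {xs = applyUpTo suc m} k∈
... | k∈upTo , k∣m with ∈-applyUpTo⁻ suc k∈upTo
... | _ , _ , refl = _ , k∣m

divisors-unique : ∀ m → Unique (divisors m)
divisors-unique m = filter⁺ (_∣? m) (applyUpTo⁺₁ suc m (λ i<j _ → ℕ.<⇒≢ i<j ∘ ℕ.suc-injective))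

primeTo : ℕ → List ℕ → List ℕ
primeTo p = filter (λ k → ¬? (p ∣? k))

module _ {p} (prime-p : Prime p) where

  private instance
    p≢0 : NonZero p
    p≢0 = prime⇒nonZero prime-p

  -- As a prime divisor of `k`, `p` is already among its factors, so prefixing it creates a
  -- repetition.
  möbius-*-∣ : ∀ {k} .{{_ : NonZero k}} → p ∣ k → möbius (p ℕ.* k) ≡ 0ℤ
  möbius-*-∣ {k} p∣k = trans
    (möbius≡squarefreeSign {{ℕ.m*n≢0 p k}} (prime-∷ prime-p f))
    (squarefreeSign-∈ {p} {factors f} (factorisationHasAllPrimeFactors prime-p
      (subst (p ∣_) (isFactorisation f) p∣k) (factorsPrime f)))
    where
    f : PrimeFactorisation k
    f = factorise k

  -- Here `p` is a new prime: prefixing it preserves the presence or absence of repetitions and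
  -- lengthens the list by one.
  möbius-*-∤ : ∀ {k} .{{_ : NonZero k}} → p ∤ k → möbius (p ℕ.* k) ≡ ℤ.- möbius k
  möbius-*-∤ {k} p∤k = trans
    (möbius≡squarefreeSign {{ℕ.m*n≢0 p k}} (prime-∷ prime-p f))
    (trans
      (squarefreeSign-∉ {p} {factors f} (λ p∈ps → p∤k (subst (p ∣_) (sym (isFactorisation f)) (∈⇒∣product p∈ps))))
      (cong ℤ.-_ (sym (möbius≡squarefreeSign f))))
    where
    f : PrimeFactorisation k
    f = factorise k

  -- Neither list has repetitions, so it suffices to compare members. A divisor of p q not divisible
  -- by `p` is coprime to `p` and hence divides `q`; from a divisor that is a multiple of `p` the
  -- factor `p` is cancelled.
  divisors-* : ∀ q .{{_ : NonZero q}} →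
    divisors (p ℕ.* q) ↭ primeTo p (divisors q) ++ map (p ℕ.*_) (divisors q)
  divisors-* q = ∼bag⇒↭ (unique∧set⇒bag
    (divisors-unique (p ℕ.* q))
    (++⁺ (filter⁺ (λ k → ¬? (p ∣? k)) (divisors-unique q))
         (map⁺ (ℕ.*-cancelˡ-≡ _ _ p) (divisors-unique q))
         disjoint)
    (mk⇔ to from))
    where
    instance
      _ = ℕ.m*n≢0 p q
    disjoint : ∀ {k} → ¬ (k ∈ primeTo p (divisors q) × k ∈ map (p ℕ.*_) (divisors q))
    disjoint (k∈ , k∈′) with ∈-filter⁻ (λ k → ¬? (p ∣? k)) {xs = divisors q} k∈ | ∈-map⁻ (p ℕ.*_) k∈′
    ... | _ , p∤k | k′ , _ , refl = p∤k (m∣m*n k′)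
    to : ∀ {k} → k ∈ divisors (p ℕ.* q) → k ∈ primeTo p (divisors q) ++ map (p ℕ.*_) (divisors q)
    to {k} k∈ with ∈-divisors⁻ (p ℕ.* q) k∈ | p ∣? k
    ... | k≢0 , k∣pq | no p∤k = ∈-++⁺ˡ (∈-filter⁺ (λ k → ¬? (p ∣? k))
      (∈-divisors⁺ {{k≢0}} (coprime-divisor coprime k∣pq)) p∤k)
      where
      coprime : ∀ {d} → (d ∣ k) × (d ∣ p) → d ≡ 1
      coprime (d∣k , d∣p) with prime⇒irreducible prime-p d∣p
      ... | inj₁ d≡1  = d≡1
      ... | inj₂ refl = contradiction d∣k p∤k
    -- Divisibility presents `k` as `k′ * p`, whereas the mapped list has `p * k′`; hence the two
    -- uses of commutativity.
    ... | k≢0 , k∣pq | yes (divides k′ refl) = ∈-++⁺ʳ (primeTo p (divisors q))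
      (subst (_∈ map (p ℕ.*_) (divisors q)) (ℕ.*-comm p k′)
        (∈-map⁺ (p ℕ.*_) (∈-divisors⁺ {{ℕ.m*n≢0⇒m≢0 k′ {{k≢0}}}}
          (*-cancelˡ-∣ p (subst (_∣ p ℕ.* q) (ℕ.*-comm k′ p) k∣pq)))))
    from : ∀ {k} → k ∈ primeTo p (divisors q) ++ map (p ℕ.*_) (divisors q) → k ∈ divisors (p ℕ.* q)
    from k∈ with ∈-++⁻ (primeTo p (divisors q)) k∈
    ... | inj₁ k∈primeTo with ∈-divisors⁻ q (proj₁ (∈-filter⁻ (λ k → ¬? (p ∣? k)) {xs = divisors q} k∈primeTo))
    ...   | k≢0 , k∣q = ∈-divisors⁺ {{k≢0}} (∣-trans k∣q (n∣m*n p))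
    from k∈ | inj₂ k∈map with ∈-map⁻ (p ℕ.*_) k∈map
    ...   | k′ , k′∈ , refl with ∈-divisors⁻ q k′∈
    ...     | k′≢0 , k′∣q = ∈-divisors⁺ {{ℕ.m*n≢0 p k′ {{p≢0}} {{k′≢0}}}} (*-monoʳ-∣ p k′∣q)

-- Cancellation in sums of Möbius values

sumℤ : List ℤ → ℤ
sumℤ = foldr ℤ._+_ 0ℤ

sumℤ-++ : ∀ is js → sumℤ (is ++ js) ≡ sumℤ is ℤ.+ sumℤ js
sumℤ-++ []       js = sym (ℤ.+-identityˡ (sumℤ js))
sumℤ-++ (i ∷ is) js = trans (cong (λ j → i ℤ.+ j) (sumℤ-++ is js)) (sym (ℤ.+-assoc i (sumℤ is) (sumℤ js)))

sumℤ-↭ : ∀ {is js} → is ↭ js → sumℤ is ≡ sumℤ js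
sumℤ-↭ is↭js = Permutation.foldr-commMonoid (setoid ℤ) ℤ.+-0-isCommutativeMonoid (↭⇒↭ₛ is↭js)

-- Multiples of `p` in `ks` contribute 0 on the left and are filtered out on the right; every other
-- entry contributes the negative of its Möbius value.
sum-möbius-* : ∀ {p} (prime-p : Prime p) {ks} → All NonZero ks →
  sumℤ (map möbius (map (p ℕ.*_) ks)) ≡ ℤ.- sumℤ (map möbius (primeTo p ks))
sum-möbius-* prime-p [] = refl
sum-möbius-* {p} prime-p {k ∷ ks} (k≢0 ∷ ks≢0) with p ∣? k
... | yes p∣k = trans
  (cong₂ ℤ._+_ (möbius-*-∣ prime-p {{k≢0}} p∣k) (sum-möbius-* prime-p ks≢0))
  (ℤ.+-identityˡ _)
... | no p∤k = trans
  (cong₂ ℤ._+_ (möbius-*-∤ prime-p {{k≢0}} p∤k) (sum-möbius-* prime-p ks≢0))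
  (sym (ℤ.neg-distrib-+ (möbius k) _))

sum-möbius-divisors-* : ∀ {p} → Prime p → ∀ q .{{_ : NonZero q}} →
  sumℤ (map möbius (divisors (p ℕ.* q))) ≡ 0ℤ
sum-möbius-divisors-* {p} prime-p q = begin
  sumℤ (map möbius (divisors (p ℕ.* q)))
    ≡⟨ sumℤ-↭ (↭-map⁺ möbius (divisors-* prime-p q)) ⟩
  sumℤ (map möbius (primeTo p (divisors q) ++ map (p ℕ.*_) (divisors q)))
    ≡⟨ cong sumℤ (map-++ möbius (primeTo p (divisors q)) _) ⟩
  sumℤ (map möbius (primeTo p (divisors q)) ++ map möbius (map (p ℕ.*_) (divisors q)))
    ≡⟨ sumℤ-++ (map möbius (primeTo p (divisors q))) _ ⟩
  S ℤ.+ sumℤ (map möbius (map (p ℕ.*_) (divisors q)))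
    ≡⟨ cong (λ j → S ℤ.+ j) (sum-möbius-* prime-p (All.tabulate (proj₁ ∘ ∈-divisors⁻ q))) ⟩
  S ℤ.- S
    ≡⟨ ℤ.+-inverseʳ S ⟩
  0ℤ ∎
  where
  open ≡-Reasoning
  S : ℤ
  S = sumℤ (map möbius (primeTo p (divisors q)))

0≤sum-möbius-divisors : ∀ m .{{_ : NonZero m}} → 0ℚ ℚ.≤ sumℤ (map möbius (divisors m)) / 1
0≤sum-möbius-divisors m with factorise m
-- With no prime factors `m` is 1, and the sum evaluates to 1. In the other case a prime splits off
-- and the sum is 0.
... | record { factors = [] ; isFactorisation = refl } = ℚ.nonNegative⁻¹ 1ℚ
... | record { factors = p ∷ ps ; isFactorisation = refl ; factorsPrime = prime-p ∷ prime-ps } =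
  ℚ.≤-reflexive (sym (cong (_/ 1) (sum-möbius-divisors-* prime-p (product ps) {{productOfPrimes≢0 prime-ps}})))

-- Carries the cancellation, done in the integers, over to the real divisor sum of `μ`.
∑-fromℤ : ∀ {A : Set} (f : A → ℤ) xs → ∑ xs (fromℤ ∘ f) ≈ fromℤ (sumℤ (map f xs))
∑-fromℤ f []       n = refl
∑-fromℤ f (x ∷ xs) n =
  trans (cong (f x / 1 ℚ.+_) (∑-fromℤ f xs n)) (sym (/1-homo-+ (f x) (sumℤ (map f xs))))

0≤1⋆μ : ∀ m .{{_ : NonZero m}} → 0ℝ ≤ 1⋆ μ m
0≤1⋆μ m = 0≤-resp-≈ {fromℤ (sumℤ (map möbius (divisors m)))} {1⋆ μ m}
  (sym ∘ ∑-fromℤ möbius (divisors m)) (0≤fromℚ (0≤sum-möbius-divisors m))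

lemma5p1 : (n : ℕ) → .{{_ : NonZero n}} →
    (λ⁻ λ⁺ : Fin n → ℕ → ℝ) →
    (∀ (m : ℕ) → .{{_ : NonZero m}} → (i : Fin n) →
    (1⋆ (λ⁻ i) m ≤ 1⋆ μ m) × (1⋆ μ m ≤ 1⋆ (λ⁺ i) m)) →
    (m : Fin n → ℕ) → (∀ i → NonZero (m i)) →
    (∏[ i ∈ allFin n ] 1⋆ μ (m i))
    ≥ (∑[ i ∈ allFin n ] (1⋆ (λ⁻ i) (m i) * (∏[ j ∈ allExcept i ] 1⋆ (λ⁺ j) (m j))))
    - fromℤ (+ (n ∸ 1)) * (∏[ i ∈ allFin n ] 1⋆ (λ⁺ i) (m i))
lemma5p1 n λ⁻ λ⁺ bounds m m≢0 =
  ∑-[n-1]∏≤∏ Fin._≟_ (λ i → 1⋆ (λ⁻ i) (m i)) (λ i → 1⋆ μ (m i)) (λ i → 1⋆ (λ⁺ i) (m i))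
    (λ i → 0≤1⋆μ (m i) {{m≢0 i}})
    (λ i → proj₁ (bounds (m i) {{m≢0 i}} i))
    (λ i → proj₂ (bounds (m i) {{m≢0 i}} i))
    -- `allExcept i` unfolds to `without Fin._≟_ i (allFin n)`, so the two agree by `refl` as lists
    -- of indices.
    (allFin n) (n ∸ 1) allExcept (λ _ → refl) (allFin⁺ n)
    -- Since `n` is positive, the truncated `n ∸ 1` is a true predecessor.
    (trans (length-tabulate {n = n} (λ i → i)) (sym (ℕ.suc-pred n)))
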